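{- Let $S$ be a specular set on the finite alphabet $A$ relative to the involution $\theta$. Then $S$ is orientable if and only if there is a partition $A=A_+\cup A_-$ of the alphabet $A$ and a tree set $T$ of characteristic $1$ on the alphabet $A_+$ such that $S=T\cup T^{ -1}$, where $T^{ -1}=\{x^{ -1}\mid x\in T\}$.
   Context: Words are over a finite alphabet $A$; $\varepsilon$ is the empty word. A set $S$ of words on $A$ is factorial if it contains $A$ and all the factors of its elements (factorial sets of words over a sub-alphabet are understood with respect to that sub-alphabet). For $w\in S$ let $L(w)=\{a\in A\mid aw\in S\}$, $R(w)=\{a\in A\mid wa\in S\}$, $B(w)=\{(a,b)\in A\times A\mid awb\in S\}$. A factorial set $S$ is biextendable if $B(w)\neq\emptyset$ for all $w\in S$. The extension graph $\mathcal{E}(w)$ is the undirected graph whose vertex set is the disjoint union of $L(w)$ and $R(w)$ and whose edges are the pairs in $B(w)$. A biextendable set $S$ is a tree set of characteristic $c$ if $\mathcal{E}(w)$ is a tree for every nonempty $w\in S$ and $\mathcal{E}(\varepsilon)$ is a disjoint union of $c$ trees. Let $\theta$ be an involution on $A$ (possibly with fixed points) and let $G_\theta$ be the group generated by $A$ with relations $a\theta(a)=1$, $a\in A$ (so $a^{ -1}=\theta(a)$). A word is reduced if it has no factor $a\theta(a)$ with $a\in A$; the inverse $x^{ -1}$ in $G_\theta$ of a reduced word $x=a_1\cdots a_n$ is the reduced word $\theta(a_n)\cdots\theta(a_1)$. A laminary set on $A$ relative to $\theta$ is a biextendable set of reduced words closed under taking inverses. A specular set is a laminary set which is a tree set of characteristic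 $2$. A laminary set $S$ is orientable if there exist two sets $S_+,S_-$, each closed under taking factors, such that $S=S_+\cup S_-$, $S_+\cap S_-=\{\varepsilon\}$, and for any $x\in S$ one has $x\in S_-$ if and only if $x^{ -1}\in S_+$. -}

module Defs where

open import Level using (0ℓ)
open import Data.Empty using (⊥)
open import Data.Fin.Base using (Fin)
open import Data.List.Base using (List; []; _∷_; _∷ʳ_; [_]; map; reverse; length)
open import Data.List.Relation.Binary.Infix.Heterogeneous using (Infix; here; there; _ⁱ++_)
open import Data.List.Relation.Binary.Pointwise using (≡⇒Pointwise-≡)
import Data.List.Relation.Binary.Prefix.Heterogeneous.Properties as Prefix
open import Data.List.Relation.Unary.All using (All)
open import Data.List.Relation.Unary.Linked using (Linked)
open import Data.List.Relation.Unary.Unique.Propositional using (Unique)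
open import Data.Nat.Base using (ℕ; _≤_)
open import Data.Product.Base using (∃-syntax; Σ-syntax; _×_; _,_)
open import Data.Sum.Base using (_⊎_; inj₁; inj₂)
open import Function.Bundles using (_⇔_)
open import Relation.Binary.Construct.Closure.ReflexiveTransitive using (Star)
open import Relation.Binary.Core using (Rel)
open import Relation.Binary.PropositionalEquality.Core using (_≡_; _≢_; refl)
open import Relation.Nullary.Negation.Core using (¬_)
open import Relation.Unary using (Pred; _∈_; _⊆_; _≐_; _∪_; _∩_; ⋃; ｛_｝; U; ∅; Satisfiable; _⟨⊎⟩_)

private variable
  A X : Set

-- The vertices form a subset of X, and equality of vertices is that of X.
record Graph (X : Set) : Set₁ where
  field
    Vertex     : Pred X 0ℓ
    Edge       : Rel X 0ℓ
    edge-start : ∀ {u v} → Edge u v → u ∈ Vertex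
    edge-sym   : ∀ {u v} → Edge u v → Edge v u
    edge-irr   : ∀ {u} → ¬ Edge u u

open Graph public

Connected : Graph X → Set
Connected G = ∀ {u v} → u ∈ Vertex G → v ∈ Vertex G → Star (Edge G) u v

-- The closed walk x, xs₁, …, xsₖ, x is a simple cycle; length at least 3
-- excludes running back and forth along one edge.
IsCycle : Graph X → X → List X → Set
IsCycle G x xs = 2 ≤ length xs × Unique (x ∷ xs) × Linked (Edge G) (x ∷ xs ∷ʳ x)

Acyclic : Graph X → Set
Acyclic G = ∀ x xs → ¬ IsCycle G x xs

record IsTree (G : Graph X) : Set where
  field
    nonempty  : Satisfiable (Vertex G)
    connected : Connected G
    acyclic   : Acyclic G

record IsDisjointUnion {c : ℕ} (G : Graph X) (H : Fin c → Graph X) : Set where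
  field
    vertices : Vertex G ≐ ⋃ (Fin c) (λ i → Vertex (H i))
    disjoint : ∀ {i j v} → v ∈ Vertex (H i) → v ∈ Vertex (H j) → i ≡ j
    edges    : ∀ {u v} → Edge G u v ⇔ (∃[ i ] Edge (H i) u v)

IsDisjointUnionOfTrees : ℕ → Graph X → Set₁
IsDisjointUnionOfTrees {X} c G =
  Σ[ H ∈ (Fin c → Graph X) ] IsDisjointUnion G H × (∀ i → IsTree (H i))

Word : Set → Set
Word A = List A

WordSet : Set → Set₁
WordSet A = Pred (Word A) 0ℓ

_FactorOf_ : Word A → Word A → Set
_FactorOf_ = Infix _≡_

FactorClosed : WordSet A → Set
FactorClosed S = ∀ {u w} → u FactorOf w → w ∈ S → u ∈ S

-- Alph is the sub-alphabet over which S is considered; Alph = U gives the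
-- notion for the whole alphabet A.
record IsFactorial (Alph : Pred A 0ℓ) (S : WordSet A) : Set where
  field
    words   : S ⊆ All Alph
    letters : ∀ {a} → a ∈ Alph → [ a ] ∈ S
    factors : FactorClosed S

-- No restriction of the letters to the sub-alphabet is needed below: it
-- follows from the field `words` when S is factorial.

L : WordSet A → Word A → Pred A 0ℓ
L S w a = (a ∷ w) ∈ S

R : WordSet A → Word A → Pred A 0ℓ
R S w a = (w ∷ʳ a) ∈ S

B : WordSet A → Word A → Pred (A × A) 0ℓ
B S w (a , b) = (a ∷ w ∷ʳ b) ∈ S

record IsBiextendable (Alph : Pred A 0ℓ) (S : WordSet A) : Set where
  field
    factorial  : IsFactorial Alph S
    extendable : ∀ {w} → w ∈ S → Satisfiable (B S w)

-- The left copy of A carries L(w) and the right copy carries R(w).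
ExtensionEdge : WordSet A → Word A → Rel (A ⊎ A) 0ℓ
ExtensionEdge S w (inj₁ a) (inj₂ b) = (a , b) ∈ B S w
ExtensionEdge S w (inj₂ b) (inj₁ a) = (a , b) ∈ B S w
ExtensionEdge S w (inj₁ _) (inj₁ _) = ⊥
ExtensionEdge S w (inj₂ _) (inj₂ _) = ⊥

-- Factoriality ensures that the endpoints of an edge are vertices.
extensionGraph : (S : WordSet A) → FactorClosed S → Word A → Graph (A ⊎ A)
extensionGraph {A} S closed w = record
  { Vertex     = L S w ⟨⊎⟩ R S w
  ; Edge       = ExtensionEdge S w
  ; edge-start = λ {u} {v} → start u v
  ; edge-sym   = λ {u} {v} → symm u v
  ; edge-irr   = λ {u} → irr u
  }
  where
  self : ∀ (u : Word A) → u FactorOf u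
  self u = here (Prefix.fromPointwise (≡⇒Pointwise-≡ refl))

  start : ∀ u v → ExtensionEdge S w u v → u ∈ (L S w ⟨⊎⟩ R S w)
  start (inj₁ a) (inj₂ b) e = closed (self (a ∷ w) ⁱ++ [ b ]) e
  start (inj₂ b) (inj₁ a) e = closed (there (self (w ∷ʳ b))) e

  symm : ∀ u v → ExtensionEdge S w u v → ExtensionEdge S w v u
  symm (inj₁ _) (inj₂ _) e = e
  symm (inj₂ _) (inj₁ _) e = e

  irr : ∀ u → ¬ ExtensionEdge S w u u
  irr (inj₁ _) ()
  irr (inj₂ _) ()

record IsTreeSet (Alph : Pred A 0ℓ) (c : ℕ) (S : WordSet A) : Set₁ where
  field
    biextendable : IsBiextendable Alph S

  open IsBiextendable biextendable public
  open IsFactorial factorial public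

  ℰ : Word A → Graph (A ⊎ A)
  ℰ = extensionGraph S factors

  field
    tree   : ∀ {w} → w ∈ S → w ≢ [] → IsTree (ℰ w)
    forest : IsDisjointUnionOfTrees c (ℰ [])

module _ (θ : A → A) where

  IsReduced : Pred (Word A) 0ℓ
  IsReduced w = ∀ a → ¬ ((a ∷ θ a ∷ []) FactorOf w)

  -- For θ an involution and w reduced, the reduced word representing the
  -- inverse of w in the group ⟨ A ∣ a θ(a) = 1 ⟩.
  inverse : Word A → Word A
  inverse w = reverse (map θ w)

  inverseSet : WordSet A → WordSet A
  inverseSet T w = ∃[ x ] x ∈ T × w ≡ inverse x

  record IsLaminary (S : WordSet A) : Set where
    field
      biextendable : IsBiextendable U S
      reduced      : S ⊆ IsReduced
      inverses     : ∀ {w} → w ∈ S → inverse w ∈ S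

  record IsSpecular (S : WordSet A) : Set₁ where
    field
      laminary : IsLaminary S
      treeSet  : IsTreeSet U 2 S

  record IsOrientation (S S₊ S₋ : WordSet A) : Set where
    field
      closed₊ : FactorClosed S₊
      closed₋ : FactorClosed S₋
      union   : S ≐ S₊ ∪ S₋
      meet    : S₊ ∩ S₋ ≐ ｛ [] ｝
      swap    : ∀ {x} → x ∈ S → (x ∈ S₋ ⇔ inverse x ∈ S₊)

  IsOrientable : WordSet A → Set₁
  IsOrientable S = Σ[ S₊ ∈ WordSet _ ] Σ[ S₋ ∈ WordSet _ ] IsOrientation S S₊ S₋

record IsPartition (A₊ A₋ : Pred A 0ℓ) : Set where
  field
    cover    : U ≐ A₊ ∪ A₋
    disjoint : A₊ ∩ A₋ ≐ ∅

{-# OPTIONS --safe #-}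
-- (⇒) A nonempty word of S₊ extends within S only to words of S₊, since S₊ and
-- S₋ are factor-closed and share only ε.  Hence the extension graphs of S₊ are
-- unions of components of those of S; for ε, S₊ and S₋ give two nonempty unions
-- of components without common vertex, hence one tree each.
--
-- (⇐) Take S₊ = T and S₋ = T⁻¹.  The graph ℰ(ε) of S is the union of the
-- connected graphs of T and T⁻¹.  If a letter of A₊ had its inverse in A₊ then
-- these would share a vertex, so that ℰ(ε) would be connected and not a union
-- of two trees.
module Submission where

open import Defs
open import Level using (0ℓ)
open import Algebra.Definitions using (Involutive)
open import Data.Empty using (⊥-elim)
open import Data.Fin.Base using (Fin; zero; suc)
open import Data.List.Base using ([]; _∷_; _++_; _∷ʳ_; [_]; map; reverse)
open import Data.List.Properties using (map-++; map-∘; map-id; map-cong; reverse-++; reverse-map; reverse-involutive)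
import Data.List.Relation.Binary.Infix.Heterogeneous as Infix
open import Data.List.Relation.Binary.Infix.Heterogeneous using (here; there; _++ⁱ_; _ⁱ++_)
open import Data.List.Relation.Binary.Infix.Heterogeneous.Properties using (fromPointwise)
open import Data.List.Relation.Binary.Pointwise using (≡⇒Pointwise-≡; Pointwise-≡⇒≡)
open import Data.List.Relation.Binary.Prefix.Heterogeneous using ([]; _∷_)
open import Data.List.Relation.Unary.All using (All; []; _∷_)
open import Data.List.Relation.Unary.Linked as Linked using (Linked; []; [-]; _∷_)
open import Data.Nat.Base using (ℕ)
open import Data.Product.Base using (Σ-syntax; ∃-syntax; _×_; _,_; proj₁; proj₂)
open import Data.Sum.Base using (_⊎_; inj₁; inj₂)
open import Function.Base using (_∘_)
open import Function.Bundles using (_⇔_; _↔_; mk⇔; Equivalence)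
open import Relation.Binary.Construct.Closure.ReflexiveTransitive using (Star; ε; _◅_; _◅◅_; gmap)
open import Relation.Binary.Core using (_⇒_)
open import Relation.Binary.PropositionalEquality using (_≡_; _≢_; refl; sym; trans; cong; subst; module ≡-Reasoning)
open import Relation.Nullary.Negation.Core using (¬_)
open import Relation.Unary using (Pred; _∈_; _∉_; _⊆_; _≐_; _∪_; Satisfiable; U)

open Equivalence using (to; from)

private variable
  A X : Set

-- Graphs

record IsSaturatedSubgraph (H G : Graph X) : Set where
  field
    vertex    : Vertex H ⊆ Vertex G
    edge      : Edge H ⇒ Edge G
    saturated : ∀ {u v} → u ∈ Vertex H → Edge G u v → Edge H u v

edge-end : (G : Graph X) → ∀ {u v} → Edge G u v → v ∈ Vertex G
edge-end G = edge-start G ∘ edge-sym G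

module _ {H G : Graph X} (H≤G : IsSaturatedSubgraph H G) where
  open IsSaturatedSubgraph H≤G

  restrict-star : ∀ {u v} → u ∈ Vertex H → Star (Edge G) u v → Star (Edge H) u v
  restrict-star _ ε       = ε
  restrict-star u (e ◅ p) = e′ ◅ restrict-star (edge-end H e′) p
    where e′ = saturated u e

  restrict-end : ∀ {u v} → u ∈ Vertex H → Star (Edge G) u v → v ∈ Vertex H
  restrict-end u ε       = u
  restrict-end u (e ◅ p) = restrict-end (edge-end H (saturated u e)) p

  restrict-linked : ∀ {u us} → u ∈ Vertex H → Linked (Edge G) (u ∷ us) → Linked (Edge H) (u ∷ us)
  restrict-linked _ [-]     = [-]
  restrict-linked u (e ∷ p) = e′ ∷ restrict-linked (edge-end H e′) p
    where e′ = saturated u e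

  acyclic-subgraph : Acyclic G → Acyclic H
  acyclic-subgraph acyclic x xs (long , unique , walk) =
    acyclic x xs (long , unique , Linked.map edge walk)

  tree-saturatedSubgraph : IsTree G → Satisfiable (Vertex H) → IsTree H
  tree-saturatedSubgraph G-tree H-nonempty = record
    { nonempty  = H-nonempty
    ; connected = λ u v → restrict-star u (IsTree.connected G-tree (vertex u) (vertex v))
    ; acyclic   = acyclic-subgraph (IsTree.acyclic G-tree)
    }

connected-from : (G : Graph X) {r : X} →
                 (∀ {v} → v ∈ Vertex G → Star (Edge G) v r × Star (Edge G) r v) → Connected G
connected-from G reach u v = proj₁ (reach u) ◅◅ proj₂ (reach v)

module _ {c : ℕ} {G : Graph X} {H : Fin c → Graph X} (G=⋃H : IsDisjointUnion G H) where
  open IsDisjointUnion G=⋃H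

  part : ∀ i → IsSaturatedSubgraph (H i) G
  part i = record
    { vertex    = λ v → proj₂ vertices (i , v)
    ; edge      = λ e → from edges (i , e)
    ; saturated = saturated
    }
    where
    saturated : ∀ {u v} → u ∈ Vertex (H i) → Edge G u v → Edge (H i) u v
    saturated u e with to edges e
    ... | j , e′ = subst (λ k → Edge (H k) _ _) (disjoint (edge-start (H j) e′) u) e′

  part-star : (∀ i → Connected (H i)) → ∀ i {u v} → u ∈ Vertex (H i) → v ∈ Vertex (H i) →
              Star (Edge G) u v
  part-star connected i u v = gmap (λ x → x) (IsSaturatedSubgraph.edge (part i)) (connected i u v)

  acyclic-disjointUnion : (∀ i → Acyclic (H i)) → Acyclic G
  acyclic-disjointUnion acyclic x [] (() , _)
  acyclic-disjointUnion acyclic x (y ∷ ys) (long , unique , walk) with to edges (Linked.head walk)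
  ... | i , e = acyclic i x (y ∷ ys)
                  (long , unique , restrict-linked (part i) (edge-start (H i) e) walk)

connected-oneTree : {G : Graph X} → IsDisjointUnionOfTrees 1 G → Connected G
connected-oneTree (H , G=⋃H , trees) u v
  with proj₁ (IsDisjointUnion.vertices G=⋃H) u | proj₁ (IsDisjointUnion.vertices G=⋃H) v
... | zero , u′ | zero , v′ = part-star G=⋃H (λ i → IsTree.connected (trees i)) zero u′ v′

oneTree : {G : Graph X} → IsTree G → IsDisjointUnionOfTrees 1 G
oneTree {G = G} tree = (λ _ → G) , union , λ _ → tree
  where
  union : IsDisjointUnion {c = 1} G (λ _ → G)
  union = record
    { vertices = (zero ,_) , proj₂
    ; disjoint = λ { {zero} {zero} _ _ → refl }
    ; edges    = mk⇔ (zero ,_) proj₂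
    }

vertex-trees : {c : ℕ} {G : Graph X} → IsDisjointUnionOfTrees (ℕ.suc c) G → Satisfiable (Vertex G)
vertex-trees (H , G=⋃H , trees) with IsTree.nonempty (trees zero)
... | v , v∈H = v , IsSaturatedSubgraph.vertex (part G=⋃H zero) v∈H

disconnected-twoTrees : {G : Graph X} → IsDisjointUnionOfTrees 2 G → ¬ Connected G
disconnected-twoTrees (H , G=⋃H , trees) connected
  with IsTree.nonempty (trees zero) | IsTree.nonempty (trees (suc zero))
... | u , u∈ | v , v∈
  with IsDisjointUnion.disjoint G=⋃H v∈
         (restrict-end (part G=⋃H zero) u∈
           (connected (IsSaturatedSubgraph.vertex (part G=⋃H zero) u∈)
                      (IsSaturatedSubgraph.vertex (part G=⋃H (suc zero)) v∈)))
... | ()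

module _ {G H K : Graph X} (forest : IsDisjointUnionOfTrees 2 G)
         (H≤G : IsSaturatedSubgraph H G) (K≤G : IsSaturatedSubgraph K G)
         (disjoint : ∀ {v} → v ∈ Vertex H → v ∉ Vertex K) where

  tree-separated : Satisfiable (Vertex H) → Satisfiable (Vertex K) → IsTree H
  tree-separated H-nonempty (k , k∈K) = record
    { nonempty  = H-nonempty
    ; connected = λ u v → restrict-star H≤G u (star u v)
    ; acyclic   = acyclic-subgraph H≤G (acyclic-disjointUnion G=⋃F (λ i → IsTree.acyclic (trees i)))
    }
    where
    F     = proj₁ forest
    G=⋃F  = proj₁ (proj₂ forest)
    trees = proj₂ (proj₂ forest)

    component : ∀ {v} → v ∈ Vertex G → ∃[ i ] v ∈ Vertex (F i)
    component = proj₁ (IsDisjointUnion.vertices G=⋃F)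

    join : ∀ i {u v} → u ∈ Vertex (F i) → v ∈ Vertex (F i) → Star (Edge G) u v
    join = part-star G=⋃F (λ i → IsTree.connected (trees i))

    k-elsewhere : ∀ i {v} → v ∈ Vertex H → v ∈ Vertex (F i) → k ∉ Vertex (F i)
    k-elsewhere i v∈H v∈F k∈F = disjoint (restrict-end H≤G v∈H (join i v∈F k∈F)) k∈K

    star : ∀ {u v} → u ∈ Vertex H → v ∈ Vertex H → Star (Edge G) u v
    star u v with component (IsSaturatedSubgraph.vertex H≤G u)
                | component (IsSaturatedSubgraph.vertex H≤G v)
                | component (IsSaturatedSubgraph.vertex K≤G k∈K)
    ... | zero     , u′ | zero     , v′ | _             = join zero u′ v′
    ... | suc zero , u′ | suc zero , v′ | _             = join (suc zero) u′ v′
    ... | zero     , u′ | suc zero , _  | zero     , k′ = ⊥-elim (k-elsewhere zero u u′ k′)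
    ... | zero     , _  | suc zero , v′ | suc zero , k′ = ⊥-elim (k-elsewhere (suc zero) v v′ k′)
    ... | suc zero , _  | zero     , v′ | zero     , k′ = ⊥-elim (k-elsewhere zero v v′ k′)
    ... | suc zero , u′ | zero     , _  | suc zero , k′ = ⊥-elim (k-elsewhere (suc zero) u u′ k′)

-- Factors and inverses of words

factor-refl : {w : Word A} → w FactorOf w
factor-refl = fromPointwise (≡⇒Pointwise-≡ refl)

factor-∷ : ∀ {a} {w : Word A} → w FactorOf (a ∷ w)
factor-∷ = there factor-refl

factor-∷ʳ : ∀ {w : Word A} {a} → w FactorOf (w ∷ʳ a)
factor-∷ʳ = factor-refl ⁱ++ _

head-factor : ∀ {a} {w : Word A} → [ a ] FactorOf (a ∷ w)
head-factor = here (refl ∷ [])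

[]-factor : {w : Word A} → [] FactorOf w
[]-factor = here []

∷ʳ≢[] : ∀ (w : Word A) {a} → w ∷ʳ a ≢ []
∷ʳ≢[] []      ()
∷ʳ≢[] (_ ∷ _) ()

letters⇒All : {S : WordSet A} → FactorClosed S → S ⊆ All (λ a → [ a ] ∈ S)
letters⇒All closed {[]}    _ = []
letters⇒All closed {_ ∷ _} w = closed head-factor w ∷ letters⇒All closed (closed factor-∷ w)

module _ (θ : A → A) where

  inverse-++ : ∀ u v → inverse θ (u ++ v) ≡ inverse θ v ++ inverse θ u
  inverse-++ u v = trans (cong reverse (map-++ θ u v)) (reverse-++ (map θ u) (map θ v))

  inverse-factor : ∀ {u w} → u FactorOf w → inverse θ u FactorOf inverse θ w
  inverse-factor {u} f with Infix.toView f
  ... | Infix.MkView p eq s with refl ← Pointwise-≡⇒≡ eq =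
    subst (inverse θ u FactorOf_) (sym expand)
      ((inverse θ s ++ⁱ factor-refl) ⁱ++ inverse θ p)
    where
    expand : inverse θ (p ++ u ++ s) ≡ (inverse θ s ++ inverse θ u) ++ inverse θ p
    expand = trans (inverse-++ p (u ++ s)) (cong (_++ inverse θ p) (inverse-++ u s))

  module _ (θθ : Involutive _≡_ θ) where

    inverse-involutive : Involutive _≡_ (inverse θ)
    inverse-involutive w = begin
      reverse (map θ (reverse (map θ w))) ≡⟨ cong reverse (reverse-map θ (map θ w)) ⟩
      reverse (reverse (map θ (map θ w))) ≡⟨ reverse-involutive _ ⟩
      map θ (map θ w)                     ≡⟨ map-∘ w ⟨
      map (θ ∘ θ) w                       ≡⟨ map-cong θθ w ⟩
      map (λ a → a) w                     ≡⟨ map-id w ⟩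
      w                                   ∎
      where open ≡-Reasoning

    inverseSet⁻ : ∀ {T : WordSet A} {w} → w ∈ inverseSet θ T → inverse θ w ∈ T
    inverseSet⁻ {T} (x , x∈T , refl) = subst T (sym (inverse-involutive x)) x∈T

    inverseSet⁺ : ∀ {T : WordSet A} {w} → inverse θ w ∈ T → w ∈ inverseSet θ T
    inverseSet⁺ {w = w} w⁻¹∈T = inverse θ w , w⁻¹∈T , sym (inverse-involutive w)

    inverseSet-closed : {T : WordSet A} → FactorClosed T → FactorClosed (inverseSet θ T)
    inverseSet-closed closed f w = inverseSet⁺ (closed (inverse-factor f) (inverseSet⁻ w))

-- Orientations

record IsSeparated (S P : WordSet A) : Set where
  field
    subset  : P ⊆ S
    closed  : FactorClosed P
    spreads : ∀ {u w} → u FactorOf w → u ≢ [] → u ∈ P → w ∈ S → w ∈ P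

module _ {S P : WordSet A} (S-closed : FactorClosed S) (P≤S : IsSeparated S P) where
  open IsSeparated P≤S

  extensionGraph-saturated : ∀ w → IsSaturatedSubgraph (extensionGraph P closed w) (extensionGraph S S-closed w)
  extensionGraph-saturated w = record
    { vertex    = λ { {inj₁ _} → subset ; {inj₂ _} → subset }
    ; edge      = λ { {inj₁ _} {inj₂ _} → subset ; {inj₂ _} {inj₁ _} → subset }
    ; saturated = λ { {inj₁ _} {inj₂ _} → spreads (factor-refl ⁱ++ _) (λ ())
                    ; {inj₂ _} {inj₁ _} → spreads factor-∷ (∷ʳ≢[] w) }
    }

  extendable-nonempty : (∀ {w} → w ∈ S → Satisfiable (B S w)) → ∀ {w} → w ≢ [] → w ∈ P → Satisfiable (B P w)
  extendable-nonempty extendable w≢[] w with extendable (subset w)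
  ... | ab , awb = ab , spreads (there factor-∷ʳ) w≢[] w awb

  extendable-separated : (∀ {w} → w ∈ S → Satisfiable (B S w)) → ∃[ a ] [ a ] ∈ P →
                         ∀ {w} → w ∈ P → Satisfiable (B P w)
  extendable-separated extendable (a , a∈P) {[]} _ with extendable-nonempty extendable (λ ()) a∈P
  ... | (c , _) , cad = (c , a) , closed (factor-refl ⁱ++ _) cad
  extendable-separated extendable _ {_ ∷ _} w = extendable-nonempty extendable (λ ()) w

vertex-letter : {S : WordSet A} (closed : FactorClosed S) →
                Satisfiable (Vertex (extensionGraph S closed [])) → ∃[ a ] [ a ] ∈ S
vertex-letter _ (inj₁ a , a∈S) = a , a∈S
vertex-letter _ (inj₂ a , a∈S) = a , a∈S

module _ {S P Q : WordSet A} (S-tree : IsTreeSet U 2 S)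
         (P≤S : IsSeparated S P) (Q≤S : IsSeparated S Q)
         (disjoint : ∀ {a} → [ a ] ∈ P → [ a ] ∉ Q)
         (P-letter : ∃[ a ] [ a ] ∈ P) (Q-letter : ∃[ a ] [ a ] ∈ Q) where
  open IsTreeSet S-tree
  open IsSeparated P≤S using (subset; closed)

  treeSet-separated : IsTreeSet (λ a → [ a ] ∈ P) 1 P
  treeSet-separated = record
    { biextendable = record
      { factorial  = record
        { words   = letters⇒All closed
        ; letters = λ a → a
        ; factors = closed
        }
      ; extendable = extendable-separated factors P≤S extendable P-letter
      }
    ; tree   = λ {w} w∈P w≢[] →
        tree-saturatedSubgraph (extensionGraph-saturated factors P≤S w) (tree (subset w∈P) w≢[])
          (vertex w≢[] w∈P)
    ; forest = oneTree (tree-separated forest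
        (extensionGraph-saturated factors P≤S []) (extensionGraph-saturated factors Q≤S [])
        (λ { {inj₁ _} → disjoint ; {inj₂ _} → disjoint })
        (inj₁ (proj₁ P-letter) , proj₂ P-letter)
        (inj₁ (proj₁ Q-letter) , proj₂ Q-letter))
    }
    where
    vertex : ∀ {w} → w ≢ [] → w ∈ P → Satisfiable (Vertex (extensionGraph P closed w))
    vertex w≢[] w with extendable-nonempty factors P≤S extendable w≢[] w
    ... | (a , _) , awb = inj₁ a , closed (factor-refl ⁱ++ _) awb

module _ (θ : A → A) (θθ : Involutive _≡_ θ) {S : WordSet A} (specular : IsSpecular θ S) where
  open IsSpecular specular
  open IsLaminary laminary using (inverses)
  open IsTreeSet treeSet using (forest; factors; letters)

  S-letter : ∃[ a ] [ a ] ∈ S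
  S-letter = vertex-letter factors (vertex-trees forest)

  module _ {S₊ S₋ : WordSet A} (orientation : IsOrientation θ S S₊ S₋) where
    open IsOrientation orientation

    disjoint : ∀ {w} → w ≢ [] → w ∈ S₊ → w ∉ S₋
    disjoint w≢[] w₊ w₋ = w≢[] (sym (proj₁ meet (w₊ , w₋)))

    separated₊ : IsSeparated S S₊
    separated₊ = record
      { subset  = proj₂ union ∘ inj₁
      ; closed  = closed₊
      ; spreads = spreads
      }
      where
      spreads : ∀ {u w} → u FactorOf w → u ≢ [] → u ∈ S₊ → w ∈ S → w ∈ S₊
      spreads f u≢[] u w with proj₁ union w
      ... | inj₁ w₊ = w₊
      ... | inj₂ w₋ = ⊥-elim (disjoint u≢[] u (closed₋ f w₋))

    separated₋ : IsSeparated S S₋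
    separated₋ = record
      { subset  = proj₂ union ∘ inj₂
      ; closed  = closed₋
      ; spreads = spreads
      }
      where
      spreads : ∀ {u w} → u FactorOf w → u ≢ [] → u ∈ S₋ → w ∈ S → w ∈ S₋
      spreads f u≢[] u w with proj₁ union w
      ... | inj₁ w₊ = ⊥-elim (disjoint u≢[] (closed₊ f w₊) u)
      ... | inj₂ w₋ = w₋

    S₋≐inverse : S₋ ≐ inverseSet θ S₊
    S₋≐inverse = (λ w₋ → inverseSet⁺ θ θθ (to (swap (proj₂ union (inj₂ w₋))) w₋)) , backwards
      where
      backwards : inverseSet θ S₊ ⊆ S₋
      backwards {w} w₋ = from (swap w∈S) w⁻¹∈S₊
        where
        w⁻¹∈S₊ = inverseSet⁻ θ θθ w₋
        w∈S    = subst S (inverse-involutive θ θθ w) (inverses (proj₂ union (inj₁ w⁻¹∈S₊)))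

    inverse₊ : ∀ {w} → w ∈ S₊ → inverse θ w ∈ S₋
    inverse₊ w₊ = proj₂ S₋≐inverse (_ , w₊ , refl)

    letters₊₋ : (∃[ a ] [ a ] ∈ S₊) × (∃[ a ] [ a ] ∈ S₋)
    letters₊₋ with S-letter
    ... | a , a∈S with proj₁ union a∈S
    ...   | inj₁ a₊ = (a , a₊) , (θ a , inverse₊ a₊)
    ...   | inj₂ a₋ = (θ a , to (swap a∈S) a₋) , (a , a₋)

    orientation⇒partition :
      Σ[ A₊ ∈ Pred A 0ℓ ] Σ[ A₋ ∈ Pred A 0ℓ ] IsPartition A₊ A₋ ×
        (Σ[ T ∈ WordSet A ] IsTreeSet A₊ 1 T × S ≐ T ∪ inverseSet θ T)
    orientation⇒partition =
      (λ a → [ a ] ∈ S₊) , (λ a → [ a ] ∈ S₋) ,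
      record { cover    = (λ _ → proj₁ union (letters _)) , _
             ; disjoint = (λ { (a₊ , a₋) → disjoint (λ ()) a₊ a₋ }) , λ () } ,
      S₊ ,
      treeSet-separated treeSet separated₊ separated₋ (disjoint (λ ()))
        (proj₁ letters₊₋) (proj₂ letters₊₋) ,
      split ,
      λ { (inj₁ w) → proj₂ union (inj₁ w) ; (inj₂ w) → proj₂ union (inj₂ (proj₂ S₋≐inverse w)) }
      where
      split : S ⊆ S₊ ∪ inverseSet θ S₊
      split w with proj₁ union w
      ... | inj₁ w₊ = inj₁ w₊
      ... | inj₂ w₋ = inj₂ (proj₁ S₋≐inverse w₋)

  module _ {A₊ : Pred A 0ℓ} {T : WordSet A} (T-tree : IsTreeSet A₊ 1 T)
           (S≐T∪T⁻¹ : S ≐ T ∪ inverseSet θ T) where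
    private
      module T = IsTreeSet T-tree
      G = extensionGraph S factors []
      H = extensionGraph T T.factors []

    ⊆S : T ⊆ S
    ⊆S = proj₂ S≐T∪T⁻¹ ∘ inj₁

    flip : A ⊎ A → A ⊎ A
    flip (inj₁ a) = inj₂ (θ a)
    flip (inj₂ a) = inj₁ (θ a)

    flip-involutive : ∀ v → flip (flip v) ≡ v
    flip-involutive (inj₁ a) = cong inj₁ (θθ a)
    flip-involutive (inj₂ a) = cong inj₂ (θθ a)

    star⁺ : ∀ {u v} → u ∈ Vertex H → v ∈ Vertex H → Star (Edge G) u v
    star⁺ u v = gmap (λ x → x) (λ {x} {y} → edge x y) (connected-oneTree T.forest u v)
      where
      edge : ∀ x y → Edge H x y → Edge G x y
      edge (inj₁ _) (inj₂ _) = ⊆S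
      edge (inj₂ _) (inj₁ _) = ⊆S

    star⁻ : ∀ {u v} → flip u ∈ Vertex H → flip v ∈ Vertex H → Star (Edge G) u v
    star⁻ {u} {v} fu fv =
      subst (λ x → Star (Edge G) x v) (flip-involutive u)
        (subst (Star (Edge G) _) (flip-involutive v)
          (gmap flip (λ {x} {y} → edge x y) (connected-oneTree T.forest fu fv)))
      where
      edge : ∀ x y → Edge H x y → Edge G (flip x) (flip y)
      edge (inj₁ _) (inj₂ _) = inverses ∘ ⊆S
      edge (inj₂ _) (inj₁ _) = inverses ∘ ⊆S

    vertex-split : ∀ v → v ∈ Vertex G → v ∈ Vertex H ⊎ flip v ∈ Vertex H
    vertex-split (inj₁ _) v with proj₁ S≐T∪T⁻¹ v
    ... | inj₁ v₊ = inj₁ v₊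
    ... | inj₂ v₋ = inj₂ (inverseSet⁻ θ θθ v₋)
    vertex-split (inj₂ _) v with proj₁ S≐T∪T⁻¹ v
    ... | inj₁ v₊ = inj₁ v₊
    ... | inj₂ v₋ = inj₂ (inverseSet⁻ θ θθ v₋)

    inverse-letter∉T : ∀ {a} → [ a ] ∈ T → [ θ a ] ∉ T
    inverse-letter∉T {a} a∈T θa∈T = disconnected-twoTrees forest (connected-from G {inj₁ a} reach)
      where
      reach : ∀ {v} → v ∈ Vertex G → Star (Edge G) v (inj₁ a) × Star (Edge G) (inj₁ a) v
      reach {v} v∈G with vertex-split v v∈G
      ... | inj₁ v₊ = star⁺ v₊ a∈T , star⁺ a∈T v₊
      ... | inj₂ v₋ = star⁻ v₋ θa∈T , star⁻ θa∈T v₋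

    treeSet⇒orientation : IsOrientation θ S T (inverseSet θ T)
    treeSet⇒orientation = record
      { closed₊ = T.factors
      ; closed₋ = T⁻¹-closed
      ; union   = S≐T∪T⁻¹
      ; meet    = meet , λ { refl → []∈T , inverseSet⁺ θ θθ []∈T }
      ; swap    = λ _ → mk⇔ (inverseSet⁻ θ θθ) (inverseSet⁺ θ θθ)
      }
      where
      T⁻¹-closed : FactorClosed (inverseSet θ T)
      T⁻¹-closed = inverseSet-closed θ θθ T.factors

      []∈T : [] ∈ T
      []∈T = T.factors []-factor (proj₂ (vertex-letter T.factors (vertex-trees T.forest)))

      meet : ∀ {w} → w ∈ T × w ∈ inverseSet θ T → [] ≡ w
      meet {[]}    _         = refl
      meet {_ ∷ _} (w₊ , w₋) = ⊥-elim
        (inverse-letter∉T (T.factors head-factor w₊)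
          (inverseSet⁻ θ θθ (T⁻¹-closed head-factor w₋)))

theorem4p4 : ∀ (n : ℕ) (A : Set) → A ↔ Fin n →
    ∀ (θ : A → A) → Involutive _≡_ θ →
    ∀ (S : WordSet A) → IsSpecular θ S →
    IsOrientable θ S ⇔
    (Σ[ A₊ ∈ Pred A 0ℓ ] Σ[ A₋ ∈ Pred A 0ℓ ] IsPartition A₊ A₋ ×
    (Σ[ T ∈ WordSet A ] IsTreeSet A₊ 1 T × S ≐ T ∪ inverseSet θ T))
theorem4p4 _ _ _ θ θθ S specular = mk⇔
  (λ { (_ , _ , orientation) → orientation⇒partition θ θθ specular orientation })
  (λ { (_ , _ , _ , T , T-tree , S≐T∪T⁻¹) →
       T , inverseSet θ T , treeSet⇒orientation θ θθ specular T-tree S≐T∪T⁻¹ })
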